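{- Let $\mathbb{R} = A \cup B$ be a partition of $\mathbb{R}$ into two disjoint sets $A$ and $B$, each viewed as a suborder of $(\mathbb{R},<)$. Then there is an open interval $I = (a,b)$, with $-\infty \le a < b \le \infty$, such that $A \cap I$ is not order-isomorphic to $B \cap I$. Equivalently, $\mathbb{R}$ cannot be partitioned into two everywhere isomorphic sets.
   Context: Two disjoint sets $A, B \subseteq \mathbb{R}$ are called everywhere isomorphic if for every open interval $I=(a,b)$ with $-\infty\le a<b\le\infty$ (so $a=-\infty$, $b=\infty$ are allowed), the suborders $A\cap I$ and $B\cap I$ of $(\mathbb{R},<)$ are order-isomorphic. -}

module Defs where

open import Data.Product using (_×_; ∃; ∃-syntax; proj₁)
open import Data.Rational as ℚ using (ℚ)
open import Data.Sum using (_⊎_)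
open import Function using (_⇔_; _on_)
open import Level using (Level; 0ℓ; suc; _⊔_)
open import Relation.Binary using (Rel; _Respects_)
open import Relation.Binary.Morphism.Structures using (IsOrderIsomorphism)
open import Relation.Nullary.Construct.Add.Extrema using (_±; [_])
open import Relation.Unary using (Pred; Satisfiable; Universal; _∪_; _∩_; _⊥_; _≐_)
import Relation.Binary.Construct.Add.Extrema.Strict as Strict

private
  variable
    ℓ ℓ₁ ℓ₂ : Level

-- Dedekind reals: two-sided cuts of ℚ.
record ℝ : Set₁ where
  field
    lower           : Pred ℚ 0ℓ
    upper           : Pred ℚ 0ℓ
    lower-inhabited : Satisfiable lower
    upper-inhabited : Satisfiable upper
    lower-rounded   : ∀ q → lower q ⇔ (∃[ r ] (q ℚ.< r × lower r))
    upper-rounded   : ∀ q → upper q ⇔ (∃[ r ] (r ℚ.< q × upper r))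
    disjoint        : lower ⊥ upper
    located         : ∀ {q r} → q ℚ.< r → lower q ⊎ upper r

open ℝ

infix 4 _≈_ _<_

-- Equality of reals: cuts are compared extensionally.
_≈_ : Rel ℝ 0ℓ
x ≈ y = lower x ≐ lower y × upper x ≐ upper y

_<_ : Rel ℝ 0ℓ
x < y = ∃[ q ] (upper x q × lower y q)

-- ℝ ± is ℝ with ⊥± (that is, -∞) and ⊤± (that is, ∞) adjoined.
open Strict _<_ public using (_<±_)

Interval : ℝ ± → ℝ ± → Pred ℝ (suc 0ℓ)
Interval a b x = a <± [ x ] × [ x ] <± b

-- P and Q carry the equality and the strict order inherited from ℝ; the
-- isomorphism is required to respect that equality.
OrderIsomorphic : Pred ℝ ℓ₁ → Pred ℝ ℓ₂ → Set (suc 0ℓ ⊔ ℓ₁ ⊔ ℓ₂)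
OrderIsomorphic P Q =
  ∃ λ (f : ∃ P → ∃ Q) →
    IsOrderIsomorphism (_≈_ on proj₁) (_≈_ on proj₁) (_<_ on proj₁) (_<_ on proj₁) f

-- A subset of ℝ is a predicate that does not distinguish equal reals.
record IsPartition (A B : Pred ℝ ℓ) : Set (suc 0ℓ ⊔ ℓ) where
  field
    A-resp-≈ : A Respects _≈_
    B-resp-≈ : B Respects _≈_
    disjoint : A ⊥ B
    covers   : Universal (A ∪ B)

EverywhereIsomorphic : Pred ℝ ℓ → Pred ℝ ℓ → Set (suc 0ℓ ⊔ ℓ)
EverywhereIsomorphic A B =
  ∀ a b → a <± b → OrderIsomorphic (A ∩ Interval a b) (B ∩ Interval a b)

{-# OPTIONS --safe #-}
-- An order isomorphism between A and B on (c, d) extends, by suprema and the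
-- identity outside, to an automorphism of ℝ that exchanges A and B on (c, d),
-- so it has no fixed points there. Take such F on (a, d) and G on (c, d) with
-- a < c < d, replaced by their inverses if necessary so that F c > c and
-- G y > y for some y in (c, d). The supremum of the orbit of y under G² is a
-- fixed point of G², hence not below d, so some even power H of G has H y > F y, while
-- H c = c < F c. Hence F w = H w for some w in (c, y) (Knaster–Tarski for
-- H⁻¹ F), but F exchanges A and B at w whereas H preserves them.

module Submission where

open import Defs hiding (_≈_; _<_)
import Defs as Cut
open import Axiom.ExcludedMiddle using (ExcludedMiddle)
open import Data.Empty using (⊥-elim)
open import Data.Nat using (ℕ; zero; suc)
open import Data.Product using (_×_; ∃; ∃₂; _,_; proj₁; proj₂; swap; map₂)
open import Data.Rational as ℚ using (ℚ; 0ℚ; 1ℚ)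
import Data.Rational.Properties as ℚ
open import Data.Sum using (_⊎_; inj₁; inj₂; [_,_]′)
open import Function using (flip; _∘_; _on_; id; Equivalence; mk⇔)
open import Level using (Level; 0ℓ; _⊔_; Setω)
open import Relation.Binary
  using (Rel; REL; tri<; tri≈; tri>; Dense; Trans; Transitive; Trichotomous; _Respects_; StrictTotalOrder)
open import Relation.Binary.Morphism.Structures using (IsOrderIsomorphism)
open import Relation.Binary.PropositionalEquality using (_≡_; refl; subst)
open import Relation.Binary.Structures.Biased using (isStrictTotalOrderᶜ)
import Relation.Binary.Construct.Add.Extrema.Strict as Strict
open import Relation.Nullary using (¬_; yes; no)
open import Relation.Nullary.Construct.Add.Extrema using ([_])
open import Relation.Nullary.Decidable using (True; toWitness; fromWitness; decidable-stable; from-yes; _×-dec_)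
open import Relation.Unary using (Pred; Satisfiable; Universal; _∩_; _∪_; _⊥_)

private
  variable
    o ℓ ℓ₁ ℓ₂ : Level

-- Strict total orders and their automorphisms.

module Order (O : StrictTotalOrder o ℓ₁ ℓ₂) where

  open StrictTotalOrder O public
    using (Carrier; _≈_; _<_; _<?_; compare; module Eq)
    renaming (trans to <-trans; asym to <-asym; irrefl to <-irrefl)

  variable
    x x′ y y′ z u v c d : Carrier

  infix 4 _≤_ _∈⟨_,_⟩

  -- By trichotomy this negation is the usual weak order, so each proof of `≤` below starts from a
  -- strict inequality and refutes it.
  _≤_ : Rel Carrier _
  x ≤ y = ¬ y < x

  _∈⟨_,_⟩ : Carrier → Carrier → Carrier → Set _
  x ∈⟨ c , d ⟩ = c < x × x < d

  ≤-refl : x ≤ x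
  ≤-refl = <-irrefl Eq.refl

  ≈⇒≤ : x ≈ y → x ≤ y
  ≈⇒≤ x≈y = <-irrefl (Eq.sym x≈y)

  ≈⇒≥ : x ≈ y → y ≤ x
  ≈⇒≥ = <-irrefl

  ≤-antisym : x ≤ y → y ≤ x → x ≈ y
  ≤-antisym {x} {y} x≤y y≤x with compare x y
  ... | tri< x<y _ _ = ⊥-elim (y≤x x<y)
  ... | tri≈ _ x≈y _ = x≈y
  ... | tri> _ _ y<x = ⊥-elim (x≤y y<x)

  ≤∧≉⇒< : x ≤ y → ¬ x ≈ y → x < y
  ≤∧≉⇒< {x} {y} x≤y x≉y with compare x y
  ... | tri< x<y _ _ = x<y
  ... | tri≈ _ x≈y _ = ⊥-elim (x≉y x≈y)
  ... | tri> _ _ y<x = ⊥-elim (x≤y y<x)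

  ≤-<-trans : Trans _≤_ _<_ _<_
  ≤-<-trans {x} {y} {z} x≤y y<z =
    ≤∧≉⇒< (λ z<x → x≤y (<-trans y<z z<x)) (λ x≈z → x≤y (StrictTotalOrder.<-respʳ-≈ O (Eq.sym x≈z) y<z))

  <-≤-trans : Trans _<_ _≤_ _<_
  <-≤-trans {x} {y} {z} x<y y≤z =
    ≤∧≉⇒< (λ z<x → y≤z (<-trans z<x x<y)) (λ x≈z → y≤z (StrictTotalOrder.<-respˡ-≈ O x≈z x<y))

  ≤-trans : Transitive _≤_
  ≤-trans x≤y y≤z z<x = y≤z (<-≤-trans z<x x≤y)

  record Supremum (S : Pred Carrier ℓ) : Set (o ⊔ ℓ₂ ⊔ ℓ) where
    field
      sup     : Carrier
      isUpper : S x → x ≤ sup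
      isLeast : z < sup → ∃ λ x → S x × z < x

    least : (∀ {x} → S x → x ≤ u) → sup ≤ u
    least bound u<sup with isLeast u<sup
    ... | _ , Sx , u<x = bound Sx u<x

  -- Imposed on both `R` and `flip R`, this makes `R` the graph of a partial order isomorphism,
  -- single-valued and injective up to `≈`.
  Increasing : REL Carrier Carrier ℓ → Set _
  Increasing R = ∀ {x x′ y y′} → R x y → R x′ y′ → x < x′ → y < y′

  DenseDomain : REL Carrier Carrier ℓ → Set _
  DenseDomain R = ∀ {u v} → u < v → ∃₂ λ x y → R x y × x ∈⟨ u , v ⟩

  record Automorphism : Set (o ⊔ ℓ₁ ⊔ ℓ₂) where
    field
      to from   : Carrier → Carrier
      to-mono   : x < y → to x < to y
      from-mono : x < y → from x < from y
      from∘to   : ∀ x → from (to x) ≈ x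
      to∘from   : ∀ x → to (from x) ≈ x

    to-mono-≤ : x ≤ y → to x ≤ to y
    to-mono-≤ {x} {y} x≤y ty<tx =
      x≤y (≤-<-trans (≈⇒≥ (from∘to y)) (<-≤-trans (from-mono ty<tx) (≈⇒≤ (from∘to x))))

    -- Equality amounts to `≤` in both directions, so congruence comes from weak monotonicity.
    to-cong : x ≈ y → to x ≈ to y
    to-cong x≈y = ≤-antisym (to-mono-≤ (≈⇒≤ x≈y)) (to-mono-≤ (≈⇒≥ x≈y))

  open Automorphism

  identity : Automorphism
  identity = record
    { to = id ; from = id ; to-mono = id ; from-mono = id
    ; from∘to = λ _ → Eq.refl ; to∘from = λ _ → Eq.refl }

  inverse : Automorphism → Automorphism
  inverse F = record
    { to = from F ; from = to F ; to-mono = from-mono F ; from-mono = to-mono F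
    ; from∘to = to∘from F ; to∘from = from∘to F }

  infixr 9 _∙_

  _∙_ : Automorphism → Automorphism → Automorphism
  F ∙ G = record
    { to        = to F ∘ to G
    ; from      = from G ∘ from F
    ; to-mono   = to-mono F ∘ to-mono G
    ; from-mono = from-mono G ∘ from-mono F
    ; from∘to   = λ x → Eq.trans (to-cong (inverse G) (from∘to F (to G x))) (from∘to G x)
    ; to∘from   = λ x → Eq.trans (to-cong F (to∘from G (from F x))) (to∘from F x)
    }

  power : Automorphism → ℕ → Automorphism
  power F zero    = identity
  power F (suc n) = F ∙ power F n

-- Lives in `Setω` because suprema are taken of predicates at several universe levels: images,
-- orbits, sets of post-fixed points.
record IsContinuum (O : StrictTotalOrder o ℓ₁ ℓ₂) : Setω where
  open Order O
  field
    <-dense    : Dense _<_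
    unboundedˡ : ∀ x → ∃ (_< x)
    unboundedʳ : ∀ x → ∃ (x <_)
    supremum   : ∀ {u} (S : Pred Carrier ℓ) → Satisfiable S → (∀ {x} → S x → x ≤ u) → Supremum S

module Continuum {O : StrictTotalOrder o ℓ₁ ℓ₂} (isContinuum : IsContinuum O) where

  open Order O
  open Automorphism
  open Supremum
  open IsContinuum isContinuum

  -- Extending a dense partial isomorphism by suprema.

  module Extension (R : REL Carrier Carrier ℓ) (incr : Increasing R) (dense : DenseDomain R) where

    Image : Carrier → Pred Carrier _
    Image x y′ = ∃ λ x′ → R x′ y′ × x′ < x

    Image-sup : ∀ x → Supremum (Image x)
    Image-sup x =
      -- Domain points on either side of `x`: the value at the left one inhabits the image, the
      -- value at the right one bounds it.
      let _ , u<x = unboundedˡ x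
          x₁ , y₁ , Rxy₁ , _ , x₁<x = dense u<x
          _ , x<v = unboundedʳ x
          x₂ , y₂ , Rxy₂ , x<x₂ , _ = dense x<v
      in supremum (Image x) (y₁ , x₁ , Rxy₁ , x₁<x)
           λ (_ , Rxy , x′<x) → <-asym (incr Rxy Rxy₂ (<-trans x′<x x<x₂))

    extend : Carrier → Carrier
    extend x = sup (Image-sup x)

    image≤extend : R x y → x < z → y ≤ extend z
    image≤extend Rxy x<z = isUpper (Image-sup _) (_ , Rxy , x<z)

    extend≤image : R x y → z ≤ x → extend z ≤ y
    extend≤image Rxy z≤x = least (Image-sup _)
      λ (_ , Rxy′ , x′<z) → <-asym (incr Rxy′ Rxy (<-≤-trans x′<z z≤x))

    -- Two domain points fit between `x` and `y`; their values separate the two suprema strictly.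
    extend-mono : x < y → extend x < extend y
    extend-mono x<y =
      let x₁ , _ , Rxy₁ , x<x₁ , x₁<y = dense x<y
          x₂ , _ , Rxy₂ , x₁<x₂ , x₂<y = dense x₁<y
      in ≤-<-trans (extend≤image Rxy₁ (<-asym x<x₁))
           (<-≤-trans (incr Rxy₁ Rxy₂ x₁<x₂) (image≤extend Rxy₂ x₂<y))

  module ExtensionInverse (R : REL Carrier Carrier ℓ)
    (incr : Increasing R) (incr⁻¹ : Increasing (flip R))
    (dense : DenseDomain R) (dense⁻¹ : DenseDomain (flip R)) where

    open Extension R incr dense
    private module Inv = Extension (flip R) incr⁻¹ dense⁻¹

    -- Density of the range excludes a jump: a gap between `extend x` and `y` would contain the
    -- value at some domain point left of `x`, which `extend x` already bounds.
    extend-extends : R x y → extend x ≈ y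
    extend-extends Rxy = ≤-antisym (extend≤image Rxy ≤-refl) λ ex<y →
      let _ , _ , Rxy′ , ex<y′ , y′<y = dense⁻¹ ex<y
      in image≤extend Rxy′ (incr⁻¹ Rxy′ Rxy y′<y) ex<y′

    -- A gap between `x` and its round trip would contain a domain point. There `extend` agrees with
    -- `R`, which puts the round trip on the wrong side of that point.
    inverse-extend : ∀ x → Inv.extend (extend x) ≈ x
    inverse-extend x = ≤-antisym
      (λ x<gx → let _ , _ , Rxy , x<x′ , x′<gx = dense x<gx in
        Inv.extend≤image Rxy (≤-trans (<-asym (extend-mono x<x′)) (≈⇒≤ (extend-extends Rxy))) x′<gx)
      (λ gx<x → let _ , _ , Rxy , gx<x′ , x′<x = dense gx<x in
        Inv.image≤extend Rxy (≤-<-trans (≈⇒≥ (extend-extends Rxy)) (extend-mono x′<x)) gx<x′)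

  extension : (R : REL Carrier Carrier ℓ) → Increasing R → Increasing (flip R) →
    DenseDomain R → DenseDomain (flip R) →
    ∃ λ F → ∀ {x y} → R x y → to F x ≈ y × from F y ≈ x
  extension R i i⁻¹ d d⁻¹ = record
    { to = Fwd.extend ; from = Bwd.extend
    ; to-mono = Fwd.extend-mono ; from-mono = Bwd.extend-mono
    ; from∘to = FwdI.inverse-extend ; to∘from = BwdI.inverse-extend
    } , λ Rxy → FwdI.extend-extends Rxy , BwdI.extend-extends Rxy
    where
    module Fwd = Extension R i d
    module Bwd = Extension (flip R) i⁻¹ d⁻¹
    module FwdI = ExtensionInverse R i i⁻¹ d d⁻¹
    module BwdI = ExtensionInverse (flip R) i⁻¹ i d⁻¹ d

  -- Gluing with the identity outside an interval.

  module Glue (c d : Carrier) where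

    -- Asking for both coordinates in the interval makes the relation symmetric under `flip` and
    -- keeps inside values correctly ordered against the fixed points outside.
    data Glue (P : REL Carrier Carrier ℓ) : REL Carrier Carrier (o ⊔ ℓ₂ ⊔ ℓ) where
      inside  : P x y → x ∈⟨ c , d ⟩ → y ∈⟨ c , d ⟩ → Glue P x y
      outside : ¬ x ∈⟨ c , d ⟩ → Glue P x x

    Glue-increasing : {P : REL Carrier Carrier ℓ} → Increasing P → Increasing (Glue P)
    Glue-increasing i (inside Pxy _ _)  (inside Pxy′ _ _) x<x′ = i Pxy Pxy′ x<x′
    Glue-increasing i (inside _ (c<x , _) (_ , y<d)) (outside x′∉) x<x′ =
      <-≤-trans y<d λ x′<d → x′∉ (<-trans c<x x<x′ , x′<d)
    Glue-increasing i (outside x∉) (inside _ (_ , x′<d) (c<y′ , _)) x<x′ =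
      ≤-<-trans (λ c<x → x∉ (c<x , <-trans x<x′ x′<d)) c<y′
    Glue-increasing i (outside _) (outside _) x<x′ = x<x′

    Glue-flip : {P : REL Carrier Carrier ℓ} → Glue (flip P) x y → Glue P y x
    Glue-flip (inside Pyx x∈ y∈) = inside Pyx y∈ x∈
    Glue-flip (outside x∉)       = outside x∉

    DenseInside : REL Carrier Carrier ℓ → Set _
    DenseInside P = ∀ {u v} → c ≤ u → v ≤ d → u < v →
      ∃₂ λ x y → P x y × x ∈⟨ u , v ⟩ × y ∈⟨ c , d ⟩

    Glue-dense : {P : REL Carrier Carrier ℓ} → DenseInside P → DenseDomain (Glue P)
    Glue-dense {P = P} dense {u} {v} u<v with <-dense u<v
    -- If `w` lies outside the interval, the pair of `w` with itself is in the relation. Otherwise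
    -- the search moves to the part of (`u`, `w`) above `c`, which stays inside.
    ... | w , u<w , w<v with (c <? w) ×-dec (w <? d)
    ...   | no w∉ = w , w , outside w∉ , u<w , w<v
    ...   | yes (c<w , w<d) with c <? u
    ...     | yes c<u =
      let x , y , Pxy , (u<x , x<w) , y∈ = dense (<-asym c<u) (<-asym w<d) u<w
      in x , y , inside Pxy (<-trans c<u u<x , <-trans x<w w<d) y∈ , u<x , <-trans x<w w<v
    ...     | no u≤c =
      let x , y , Pxy , (c<x , x<w) , y∈ = dense ≤-refl (<-asym w<d) c<w
      in x , y , inside Pxy (c<x , <-trans x<w w<d) y∈ , ≤-<-trans u≤c c<x , <-trans x<w w<v

    glue : (P : REL Carrier Carrier ℓ) → Increasing P → Increasing (flip P) → DenseInside P → DenseInside (flip P) →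
      ∃ λ F → ∀ {x y} → Glue P x y → to F x ≈ y × from F y ≈ x
    glue P i i⁻¹ d d⁻¹ = extension (Glue P) (Glue-increasing i)
      (λ g g′ → Glue-increasing i⁻¹ (Glue-flip g) (Glue-flip g′))
      (Glue-dense d)
      (λ u<v → let x , y , g , x∈ = Glue-dense d⁻¹ u<v in x , y , Glue-flip g , x∈)

  -- Fixed points and coincidence points.

  -- Knaster–Tarski on [c, d].
  fixed-between : ∀ M → c < d → c < to M c → to M d < d →
    ∃ λ w → w ∈⟨ c , d ⟩ × to M w ≈ w
  fixed-between {c} {d} M c<d c<Mc Md<d =
    s , (≤∧≉⇒< c≤s (λ c≈s → ≤-trans Ms≤s (≈⇒≥ c≈s) (<-≤-trans c<Mc (to-mono-≤ M c≤s)))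
        , ≤∧≉⇒< s≤d (λ s≈d → ≤-trans (≈⇒≥ s≈d) s≤Ms (≤-<-trans (to-mono-≤ M s≤d) Md<d)))
      , ≤-antisym Ms≤s s≤Ms
    where
    S : Pred Carrier _
    S x = x ≤ d × x ≤ to M x
    S-sup : Supremum S
    S-sup = supremum S (c , <-asym c<d , <-asym c<Mc) proj₁
    s = sup S-sup
    c≤s : c ≤ s
    c≤s = isUpper S-sup (<-asym c<d , <-asym c<Mc)
    s≤d : s ≤ d
    s≤d = least S-sup proj₁
    s≤Ms : s ≤ to M s
    s≤Ms = least S-sup λ Sx → ≤-trans (proj₂ Sx) (to-mono-≤ M (isUpper S-sup Sx))
    Ms≤s : to M s ≤ s
    Ms≤s = isUpper S-sup (≤-trans (to-mono-≤ M s≤d) (<-asym Md<d) , to-mono-≤ M s≤Ms)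

  -- Coincidence points are fixed points of `inverse H ∙ F`; applying `from H` to the two end
  -- inequalities gives the hypotheses of `fixed-between`.
  coincide-between : ∀ F H → c < d → to H c < to F c → to F d < to H d →
    ∃ λ w → w ∈⟨ c , d ⟩ × to F w ≈ to H w
  coincide-between {c} {d} F H c<d Hc<Fc Fd<Hd =
    let w , w∈ , Mw≈w = fixed-between (inverse H ∙ F) c<d
          (≤-<-trans (≈⇒≥ (from∘to H c)) (from-mono H Hc<Fc))
          (<-≤-trans (from-mono H Fd<Hd) (≈⇒≤ (from∘to H d)))
    in w , w∈ , Eq.trans (Eq.sym (to∘from H (to F w))) (to-cong H Mw≈w)

  -- The limit is the supremum `s` of the orbit. Each orbit point is at most its successor, hence at
  -- most `F s`. If `s < F s`, some orbit point exceeds the preimage of `s`, so its successor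
  -- exceeds `s`.
  orbit-limit : ∀ F {t} → x ≤ to F x → (∀ n → to (power F n) x ≤ t) →
    ∃ λ s → x ≤ s × s ≤ t × to F s ≈ s
  orbit-limit {x} F {t} x≤Fx bounded =
    s , isUpper orbit-sup (0 , refl) , least orbit-sup (λ { (n , refl) → bounded n }) ,
    ≤-antisym Fs≤s (least orbit-sup λ { (n , refl) →
      ≤-trans (increasing n) (to-mono-≤ F (isUpper orbit-sup (n , refl))) })
    where
    Orbit : Pred Carrier _
    Orbit y = ∃ λ n → to (power F n) x ≡ y
    orbit-sup : Supremum Orbit
    orbit-sup = supremum Orbit (x , 0 , refl) λ { (n , refl) → bounded n }
    s = sup orbit-sup
    increasing : ∀ n → to (power F n) x ≤ to F (to (power F n) x)
    increasing zero    = x≤Fx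
    increasing (suc n) = to-mono-≤ F (increasing n)
    Fs≤s : to F s ≤ s
    Fs≤s s<Fs with isLeast orbit-sup (<-≤-trans (from-mono F s<Fs) (≈⇒≤ (from∘to F s)))
    ... | _ , (n , refl) , F⁻¹s<y =
      isUpper orbit-sup (suc n , refl) (≤-<-trans (≈⇒≥ (to∘from F s)) (to-mono F F⁻¹s<y))

  -- Automorphisms exchanging the two classes on an interval.

  module Partition (em : ∀ {e} → ExcludedMiddle e) {A B : Pred Carrier ℓ}
    (A-resp-≈ : A Respects _≈_) (B-resp-≈ : B Respects _≈_) (A⊥B : A ⊥ B) (covers : Universal (A ∪ B)) where

    Opposite : Rel Carrier ℓ
    Opposite x y = (A x → B y) × (B x → A y)

    Same : Rel Carrier ℓ
    Same x y = (A x → A y) × (B x → B y)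

    opposite⇒≉ : Opposite x y → ¬ x ≈ y
    opposite⇒≉ {x} (A→B , B→A) x≈y with covers x
    ... | inj₁ Ax = A⊥B (A-resp-≈ x≈y Ax , A→B Ax)
    ... | inj₂ Bx = A⊥B (B→A Bx , B-resp-≈ x≈y Bx)

    opposite⇒¬same : Opposite x y → ¬ Same x y
    opposite⇒¬same {x} (A→B , B→A) (A→A , B→B) with covers x
    ... | inj₁ Ax = A⊥B (A→A Ax , A→B Ax)
    ... | inj₂ Bx = A⊥B (B→A Bx , B→B Bx)

    record Swap (c d : Carrier) : Set (o ⊔ ℓ₁ ⊔ ℓ₂ ⊔ ℓ) where
      field
        F        : Automorphism
        fixˡ     : to F c ≈ c
        fixʳ     : to F d ≈ d
        opposite : x ∈⟨ c , d ⟩ → Opposite x (to F x)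

      maps-into : x ∈⟨ c , d ⟩ → to F x ∈⟨ c , d ⟩
      maps-into (c<x , x<d) = ≤-<-trans (≈⇒≥ fixˡ) (to-mono F c<x) , <-≤-trans (to-mono F x<d) (≈⇒≤ fixʳ)

    fix-inverse : ∀ F → to F x ≈ x → from F x ≈ x
    fix-inverse F Fx≈x = Eq.trans (Eq.sym (to-cong (inverse F) Fx≈x)) (from∘to F _)

    -- If a point and its preimage were in the same class, applying `opposite` to the preimage would
    -- put the point in both classes.
    Swap-inverse : Swap c d → Swap c d
    Swap-inverse {c} {d} S = record
      { F = inverse F ; fixˡ = fix-inverse F fixˡ ; fixʳ = fix-inverse F fixʳ
      ; opposite = λ {x} x∈ →
          let x′∈ = ≤-<-trans (≈⇒≥ (fix-inverse F fixˡ)) (from-mono F (proj₁ x∈))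
                  , <-≤-trans (from-mono F (proj₂ x∈)) (≈⇒≤ (fix-inverse F fixʳ))
              A→B , B→A = opposite x′∈
          in (λ Ax → [ (λ Ax′ → ⊥-elim (A⊥B (Ax , B-resp-≈ (to∘from F x) (A→B Ax′)))) , id ]′ (covers (from F x)))
           , (λ Bx → [ id , (λ Bx′ → ⊥-elim (A⊥B (A-resp-≈ (to∘from F x) (B→A Bx′) , Bx))) ]′ (covers (from F x)))
      }
      where open Swap S

    -- An exchange of disjoint classes moves every interior point; if it moves `x` down, its inverse
    -- moves `x` up.
    Swap-upwards : Swap c d → x ∈⟨ c , d ⟩ → ∃ λ (S : Swap c d) → x < to (Swap.F S) x
    Swap-upwards {x = x} S x∈ with compare x (to (Swap.F S) x)
    ... | tri< x<Fx _ _ = S , x<Fx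
    ... | tri≈ _ x≈Fx _ = ⊥-elim (opposite⇒≉ (Swap.opposite S x∈) x≈Fx)
    ... | tri> _ _ Fx<x = Swap-inverse S , ≤-<-trans (≈⇒≥ (from∘to (Swap.F S) x)) (from-mono (Swap.F S) Fx<x)

    module EvenIterates {c d : Carrier} (S : Swap c d) where
      open Swap S

      even : ℕ → Automorphism
      even = power (F ∙ F)

      even-fixˡ : ∀ n → to (even n) c ≈ c
      even-fixˡ zero    = Eq.refl
      even-fixˡ (suc n) = Eq.trans (to-cong (F ∙ F) (even-fixˡ n)) (Eq.trans (to-cong F fixˡ) fixˡ)

      even-same : ∀ n → x ∈⟨ c , d ⟩ → Same x (to (even n) x) × to (even n) x ∈⟨ c , d ⟩
      even-same zero    x∈ = (id , id) , x∈
      even-same (suc n) x∈ =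
        let (A→A , B→B) , y∈ = even-same n x∈
            A→B , B→A   = opposite y∈
            A→B′ , B→A′ = opposite (maps-into y∈)
        in (B→A′ ∘ A→B ∘ A→A , A→B′ ∘ B→A ∘ B→B) , maps-into (maps-into y∈)

      -- Moving up once implies moving up twice, and likewise down, so a fixed point of the square
      -- would be one of `F`.
      F∙F-no-fixpoint : x ∈⟨ c , d ⟩ → ¬ to F (to F x) ≈ x
      F∙F-no-fixpoint {x} x∈ FFx≈x with compare x (to F x)
      ... | tri< x<Fx _ _ = ≈⇒≤ FFx≈x (<-trans x<Fx (to-mono F x<Fx))
      ... | tri≈ _ x≈Fx _ = opposite⇒≉ (opposite x∈) x≈Fx
      ... | tri> _ _ Fx<x = ≈⇒≥ FFx≈x (<-trans (to-mono F Fx<x) Fx<x)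

      -- An orbit staying at or below `t` would converge to a fixed point of the square strictly
      -- inside (`c`, `d`).
      even-exceeds : ∀ {t} → x ∈⟨ c , d ⟩ → x < to F x → t < d → ∃ λ n → t < to (even n) x
      even-exceeds {x} {t} (c<x , _) x<Fx t<d = decidable-stable em λ none →
        let s , x≤s , s≤t , FFs≈s = orbit-limit (F ∙ F) (<-asym (<-trans x<Fx (to-mono F x<Fx)))
              (λ n t<y → none (n , t<y))
        in F∙F-no-fixpoint (<-≤-trans c<x x≤s , ≤-<-trans s≤t t<d) FFs≈s

    no-swaps : Carrier → ¬ (∀ {c d} → c < d → Swap c d)
    no-swaps a swaps =
      let d , a<d      = unboundedʳ a
          c , a<c , c<d = <-dense a<d
          y , c<y , y<d = <-dense c<d
          -- `c` is interior to (`a`, `d`) but an endpoint of (`c`, `d`): `F` moves it while all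
          -- iterates of the second swap fix it.
          S , c<Fc     = Swap-upwards (swaps a<d) (a<c , c<d)
          T , y<Gy     = Swap-upwards (swaps c<d) (c<y , y<d)
          open Swap S
          open EvenIterates T
          -- The threshold is `F y`, which is below `d` because `F` maps (`a`, `d`) into itself.
          n , Fy<Hy    = even-exceeds (c<y , y<d) y<Gy (proj₂ (maps-into (<-trans a<c c<y , y<d)))
          H            = even n
          w , (c<w , w<y) , Fw≈Hw = coincide-between F H c<y (≤-<-trans (≈⇒≤ (even-fixˡ n)) c<Fc) Fy<Hy
          w<d          = <-trans w<y y<d
          (A→A , B→B) , _ = even-same n (c<w , w<d)
      in opposite⇒¬same (opposite (<-trans a<c c<w , w<d))
           (A-resp-≈ (Eq.sym Fw≈Hw) ∘ A→A , B-resp-≈ (Eq.sym Fw≈Hw) ∘ B→B)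

    -- From isomorphisms between the classes to exchanging automorphisms.

    open Strict _<_ renaming (_<±_ to _<ᵉ_) using ()

    -- Written in the extended order so that over the reals it unfolds to `Interval [ c ] [ d ]`.
    Between : Carrier → Carrier → Pred Carrier _
    Between c d x = [ c ] <ᵉ [ x ] × [ x ] <ᵉ [ d ]

    Isomorphic : Carrier → Carrier → Set _
    Isomorphic c d = ∃ λ (f : ∃ (A ∩ Between c d) → ∃ (B ∩ Between c d)) →
      IsOrderIsomorphism (_≈_ on proj₁) (_≈_ on proj₁) (_<_ on proj₁) (_<_ on proj₁) f

    module _ (iso : ∀ {c d} → c < d → Isomorphic c d) where

      -- If the chosen point of (`u`, `v`) is in `B`, its preimage under the isomorphism on that
      -- same interval is in `A`.
      A-dense : u < v → ∃ λ x → A x × x ∈⟨ u , v ⟩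
      A-dense u<v with <-dense u<v
      ... | w , u<w , w<v with covers w
      ...   | inj₁ Aw = w , Aw , u<w , w<v
      ...   | inj₂ Bw with IsOrderIsomorphism.surjective (proj₂ (iso u<v)) (w , Bw , Strict.[ u<w ] , Strict.[ w<v ])
      ...     | (x , Ax , Strict.[ u<x ] , Strict.[ x<v ]) , _ = x , Ax , u<x , x<v

      B-dense : u < v → ∃ λ x → B x × x ∈⟨ u , v ⟩
      B-dense u<v with A-dense u<v
      ... | w , Aw , u<w , w<v with proj₁ (iso u<v) (w , Aw , Strict.[ u<w ] , Strict.[ w<v ])
      ...   | x , Bx , Strict.[ u<x ] , Strict.[ x<v ] = x , Bx , u<x , x<v

      isomorphic⇒swap : c < d → Swap c d
      isomorphic⇒swap {c} {d} c<d = record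
        { F = F
        ; fixˡ = fixˡ
        ; fixʳ = fixʳ
        ; opposite = λ x∈ → A→B x∈ , B→A x∈
        }
        where
        f = proj₁ (iso c<d)
        open IsOrderIsomorphism (proj₂ (iso c<d))
        open Glue c d

        -- The value is taken up to `≈` because surjectivity reaches points only up to `≈`; the
        -- argument is taken up to `≡` so that it can be matched away.
        Graph : REL Carrier Carrier _
        Graph x y = ∃ λ p → proj₁ p ≡ x × proj₁ (f p) ≈ y

        graph-increasing : Increasing Graph
        graph-increasing (p , refl , fp≈y) (p′ , refl , fp′≈y′) x<x′ =
          ≤-<-trans (≈⇒≥ fp≈y) (<-≤-trans (mono {p} {p′} x<x′) (≈⇒≤ fp′≈y′))

        graph⁻¹-increasing : Increasing (flip Graph)
        graph⁻¹-increasing (p , refl , fp≈y) (p′ , refl , fp′≈y′) y<y′ =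
          cancel {p} {p′} (≤-<-trans (≈⇒≤ fp≈y) (<-≤-trans y<y′ (≈⇒≥ fp′≈y′)))

        between⇒∈ : Between c d x → x ∈⟨ c , d ⟩
        between⇒∈ (Strict.[ c<x ] , Strict.[ x<d ]) = c<x , x<d

        ∈⇒between : x ∈⟨ c , d ⟩ → Between c d x
        ∈⇒between (c<x , x<d) = Strict.[ c<x ] , Strict.[ x<d ]

        preimage : B y → y ∈⟨ c , d ⟩ → ∃ λ x → A x × x ∈⟨ c , d ⟩ × Graph x y
        preimage By y∈ with surjective (_ , By , ∈⇒between y∈)
        -- Surjectivity speaks of every argument equal to `p`; it is instantiated at `p` itself.
        ... | p@(x , Ax , x∈) , fp≈y = x , Ax , between⇒∈ x∈ , p , refl , fp≈y {p} Eq.refl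

        graph-dense : DenseInside Graph
        graph-dense c≤u v≤d u<v =
          let x , Ax , x∈@(u<x , x<v) = A-dense u<v
              p = x , Ax , ∈⇒between (≤-<-trans c≤u u<x , <-≤-trans x<v v≤d)
          in x , proj₁ (f p) , (p , refl , Eq.refl) , x∈ , between⇒∈ (proj₂ (proj₂ (f p)))

        graph⁻¹-dense : DenseInside (flip Graph)
        graph⁻¹-dense c≤u v≤d u<v =
          let y , By , y∈@(u<y , y<v) = B-dense u<v
              x , _ , x∈ , g = preimage By (≤-<-trans c≤u u<y , <-≤-trans y<v v≤d)
          in y , x , g , y∈ , x∈

        glued = glue Graph graph-increasing graph⁻¹-increasing graph-dense graph⁻¹-dense
        F = proj₁ glued

        to-glued : Glue Graph x y → to F x ≈ y
        to-glued g = proj₁ (proj₂ glued g)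

        from-glued : Glue Graph x y → from F y ≈ x
        from-glued g = proj₂ (proj₂ glued g)

        fixˡ : to F c ≈ c
        fixˡ = to-glued (outside λ (c<c , _) → <-irrefl Eq.refl c<c)

        fixʳ : to F d ≈ d
        fixʳ = to-glued (outside λ (_ , d<d) → <-irrefl Eq.refl d<d)

        A→B : x ∈⟨ c , d ⟩ → A x → B (to F x)
        A→B {x} x∈ Ax =
          let p = x , Ax , ∈⇒between x∈
              _ , Bfp , fp∈ = f p
          in B-resp-≈ (Eq.sym (to-glued (inside (p , refl , Eq.refl) x∈ (between⇒∈ fp∈)))) Bfp

        preimage-A : ∀ {z} → y ∈⟨ c , d ⟩ → from F y ≈ z → (∃ λ x → A x × x ∈⟨ c , d ⟩ × Graph x y) → A z
        preimage-A y∈ Fy≈z (_ , Ax , x∈ , g) =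
          A-resp-≈ (Eq.trans (Eq.sym (from-glued (inside g x∈ y∈))) Fy≈z) Ax

        -- If `F x` were in `B`, surjectivity would give it a preimage in `A`; as `F` is invertible,
        -- that preimage equals `x`, contradicting `B x`.
        B→A : x ∈⟨ c , d ⟩ → B x → A (to F x)
        B→A {x} (c<x , x<d) Bx = [ id , (λ BFx → ⊥-elim (A⊥B (preimage-A Fx∈ (from∘to F x) (preimage BFx Fx∈) , Bx))) ]′
          (covers (to F x))
          where
          Fx∈ : to F x ∈⟨ c , d ⟩
          Fx∈ = ≤-<-trans (≈⇒≥ fixˡ) (to-mono F c<x) , <-≤-trans (to-mono F x<d) (≈⇒≤ fixʳ)

    not-all-isomorphic : Carrier → ¬ (∀ {c d} → c < d → Isomorphic c d)
    not-all-isomorphic a iso = no-swaps a (isomorphic⇒swap iso)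

-- The Dedekind reals

open ℝ

private
  variable
    q r : ℚ

lower-down : ∀ x → q ℚ.< r → lower x r → lower x q
lower-down x q<r r∈x = Equivalence.from (lower-rounded x _) (_ , q<r , r∈x)

lower<upper : ∀ x → lower x q → upper x r → q ℚ.< r
lower<upper {q} {r} x lq ur with ℚ.<-cmp q r
... | tri< q<r _ _ = q<r
... | tri≈ _ refl _ = ⊥-elim (disjoint x (lq , ur))
... | tri> _ _ r<q = ⊥-elim (disjoint x (lower-down x r<q lq , ur))

<ᶜ-trans : Transitive Cut._<_
<ᶜ-trans {_} {y} {z} (q , xq , yq) (r , yr , zr) =
  q , xq , lower-down z (lower<upper y yq yr) zr

<ᶜ-irrefl : ∀ x → ¬ x Cut.< x
<ᶜ-irrefl x (_ , uq , lq) = disjoint x (lq , uq)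

≈ᶜ⇒≮ᶜ : ∀ x y → x Cut.≈ y → ¬ x Cut.< y
≈ᶜ⇒≮ᶜ x y ((_ , y⊆x) , _) (_ , uq , lq) = disjoint x (y⊆x lq , uq)

≈ᶜ-sym : ∀ x y → x Cut.≈ y → y Cut.≈ x
≈ᶜ-sym _ _ ((a , b) , (c , d)) = (b , a) , (d , c)

-- Round `q` up to `r` inside the lower cut of `x`, then locate `y` between them: were `r` above
-- `y`, it would witness `y < x`.
≮ᶜ⇒lower⊆ : ∀ x y → ¬ y Cut.< x → lower x q → lower y q
≮ᶜ⇒lower⊆ x y y≮x xq with Equivalence.to (lower-rounded x _) xq
... | r , q<r , xr = [ id , (λ yr → ⊥-elim (y≮x (r , yr , xr))) ]′ (located y q<r)

≮ᶜ⇒upper⊆ : ∀ x y → ¬ x Cut.< y → upper x q → upper y q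
≮ᶜ⇒upper⊆ x y x≮y xq with Equivalence.to (upper-rounded x _) xq
... | r , r<q , xr = [ (λ yr → ⊥-elim (x≮y (r , xr , yr))) , id ]′ (located y r<q)

q-1<q : ∀ q → q ℚ.- 1ℚ ℚ.< q
q-1<q q = subst (q ℚ.- 1ℚ ℚ.<_) (ℚ.+-identityʳ q) (ℚ.+-monoʳ-< q (from-yes (ℚ.- 1ℚ ℚ.<? 0ℚ)))

q<q+1 : ∀ q → q ℚ.< q ℚ.+ 1ℚ
q<q+1 q = subst (ℚ._< q ℚ.+ 1ℚ) (ℚ.+-identityʳ q) (ℚ.+-monoʳ-< q (from-yes (0ℚ ℚ.<? 1ℚ)))

fromℚ : ℚ → ℝ
fromℚ p = record
  { lower           = ℚ._< p
  ; upper           = p ℚ.<_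
  ; lower-inhabited = _ , q-1<q p
  ; upper-inhabited = _ , q<q+1 p
  ; lower-rounded   = λ q → mk⇔ ℚ.<-dense (λ (_ , q<r , r<p) → ℚ.<-trans q<r r<p)
  ; upper-rounded   = λ q → mk⇔ (map₂ swap ∘ ℚ.<-dense) (λ (_ , r<q , p<r) → ℚ.<-trans p<r r<q)
  ; disjoint        = λ (q<p , p<q) → ℚ.<-asym q<p p<q
  ; located         = located′
  }
  where
  located′ : q ℚ.< r → q ℚ.< p ⊎ p ℚ.< r
  located′ {q} {r} q<r with q ℚ.<? p
  ... | yes q<p = inj₁ q<p
  ... | no  q≮p = inj₂ (ℚ.≤-<-trans (ℚ.≮⇒≥ q≮p) q<r)

ℝ-unboundedˡ : ∀ x → ∃ λ y → y Cut.< x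
ℝ-unboundedˡ x with lower-inhabited x
... | q , xq with Equivalence.to (lower-rounded x q) xq
...   | r , q<r , xr = fromℚ q , r , q<r , xr

ℝ-unboundedʳ : ∀ x → ∃ λ y → x Cut.< y
ℝ-unboundedʳ x with upper-inhabited x
... | q , xq with Equivalence.to (upper-rounded x q) xq
...   | r , r<q , xr = fromℚ q , r , xr , r<q

<ᶜ-dense : Dense Cut._<_
-- The rational witnessing `x < y` is itself the intermediate real; roundedness makes both
-- inequalities strict.
<ᶜ-dense {x} {y} (q , xq , yq) with Equivalence.to (upper-rounded x q) xq | Equivalence.to (lower-rounded y q) yq
... | r , r<q , xr | s , q<s , ys = fromℚ q , (r , xr , r<q) , (s , q<s , ys)

-- Trichotomy and completeness of the reals.

module Classical (em : ∀ {e} → ExcludedMiddle e) where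

  <ᶜ-cmp : Trichotomous Cut._≈_ Cut._<_
  <ᶜ-cmp x y with em {P = x Cut.< y} | em {P = y Cut.< x}
  ... | yes x<y | _       = tri< x<y (λ x≈y → ≈ᶜ⇒≮ᶜ x y x≈y x<y) (λ y<x → <ᶜ-irrefl x (<ᶜ-trans {x} {y} {x} x<y y<x))
  ... | no x≮y  | yes y<x = tri> x≮y (λ x≈y → ≈ᶜ⇒≮ᶜ y x (≈ᶜ-sym x y x≈y) y<x) y<x
  ... | no x≮y  | no y≮x  = tri≈ x≮y
    ((≮ᶜ⇒lower⊆ x y y≮x , ≮ᶜ⇒lower⊆ y x x≮y) , (≮ᶜ⇒upper⊆ x y x≮y , ≮ᶜ⇒upper⊆ y x y≮x)) y≮x

  ℝ-strictTotalOrder : StrictTotalOrder _ _ _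
  ℝ-strictTotalOrder = record
    { Carrier = ℝ
    ; _≈_ = Cut._≈_
    ; _<_ = Cut._<_
    ; isStrictTotalOrder = isStrictTotalOrderᶜ record
      { isEquivalence = record
        { refl  = (id , id) , (id , id)
        ; sym   = λ {x} {y} → ≈ᶜ-sym x y
        ; trans = λ ((a , b) , (c , d)) ((a′ , b′) , (c′ , d′)) →
            (a′ ∘ a , b ∘ b′) , (c′ ∘ c , d ∘ d′)
        }
      ; trans   = λ {x} {y} {z} → <ᶜ-trans {x} {y} {z}
      ; compare = <ᶜ-cmp
      }
    }

  open Order ℝ-strictTotalOrder using (Supremum)

  -- The cut of the supremum quantifies over ℝ : Set₁; excluded middle
  -- brings it down to Set.
  ℝ-supremum : ∀ {u} (S : Pred ℝ ℓ) → Satisfiable S → (∀ {x} → S x → ¬ u Cut.< x) → Supremum S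
  ℝ-supremum {u = u} S (x₀ , Sx₀) bound = record
    { sup = record
      { lower           = Lower
      ; upper           = Upper
      ; lower-inhabited = _ , below Sx₀ (proj₂ (lower-inhabited x₀))
      ; upper-inhabited = upper-inhabited′
      ; lower-rounded   = λ q → mk⇔ lower-to (λ (_ , q<r , Lr) → Lower-down q<r Lr)
      ; upper-rounded   = λ q → mk⇔ upper-to λ (_ , r<q , (s , s<r , ¬Ls)) → s , ℚ.<-trans s<r r<q , ¬Ls
      ; disjoint        = λ (Lq , (_ , r<q , ¬Lr)) → ¬Lr (Lower-down r<q Lq)
      ; located         = located′
      }
    ; isUpper = λ {x} Sx (_ , (_ , r<q , ¬Lr) , xq) → ¬Lr (below Sx (lower-down x r<q xq))
    ; isLeast = λ (_ , zq , Lq) → let x , Sx , xq = toWitness Lq in x , Sx , _ , zq , xq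
    }
    where
    Lower Upper : Pred ℚ 0ℓ
    Lower q = True (em {P = ∃ λ x → S x × lower x q})
    -- The strict gap `r < q` makes this set open; the plain complement of `Lower` could have a
    -- least element.
    Upper q = ∃ λ r → r ℚ.< q × ¬ Lower r
    below : ∀ {x} → S x → lower x q → Lower q
    below Sx xq = fromWitness (_ , Sx , xq)
    Lower-down : q ℚ.< r → Lower r → Lower q
    Lower-down q<r Lr = let x , Sx , xr = toWitness Lr in below Sx (lower-down x q<r xr)
    lower-to : Lower q → ∃ λ r → q ℚ.< r × Lower r
    lower-to Lq =
      let x , Sx , xq = toWitness Lq
          r , q<r , xr = Equivalence.to (lower-rounded x _) xq
      in r , q<r , below Sx xr
    upper-to : Upper q → ∃ λ r → r ℚ.< q × Upper r
    upper-to (r , r<q , ¬Lr) = let s , r<s , s<q = ℚ.<-dense r<q in s , s<q , r , r<s , ¬Lr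
    upper-inhabited′ : Satisfiable Upper
    upper-inhabited′ with upper-inhabited u
    -- `q` is above the bound `u`, hence not in `Lower`; adding one supplies the strict gap that
    -- `Upper` demands.
    ... | q , uq = q ℚ.+ 1ℚ , q , q<q+1 q , λ Lq →
      let x , Sx , xq = toWitness Lq in bound Sx (q , uq , xq)
    located′ : q ℚ.< r → Lower q ⊎ Upper r
    located′ {q} q<r with em {P = Lower q}
    ... | yes Lq = inj₁ Lq
    ... | no ¬Lq = inj₂ (q , q<r , ¬Lq)

  ℝ-isContinuum : IsContinuum ℝ-strictTotalOrder
  ℝ-isContinuum = record
    { <-dense    = λ {x} {y} → <ᶜ-dense {x} {y}
    ; unboundedˡ = ℝ-unboundedˡ
    ; unboundedʳ = ℝ-unboundedʳ
    ; supremum   = λ {_} {u} → ℝ-supremum {u = u}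
    }

  ¬everywhereIsomorphic : {A B : Pred ℝ ℓ} → IsPartition A B → ¬ EverywhereIsomorphic A B
  ¬everywhereIsomorphic {A = A} {B} partition iso =
    Continuum.Partition.not-all-isomorphic ℝ-isContinuum em
      {A = A} {B} (λ {x} {y} → A-resp-≈ {x} {y}) (λ {x} {y} → B-resp-≈ {x} {y}) A⊥B covers
      (fromℚ 0ℚ) (λ {c} {d} c<d → iso [ c ] [ d ] Strict.[ c<d ])
    where open IsPartition partition renaming (disjoint to A⊥B)

theorem1 : (∀ {e} → ExcludedMiddle e) → ∀ {ℓ} →
    ((A B : Pred ℝ ℓ) → IsPartition A B →
    ∃₂ λ a b → a <± b × ¬ OrderIsomorphic (A ∩ Interval a b) (B ∩ Interval a b))
    × ¬ (∃₂ λ (A B : Pred ℝ ℓ) → IsPartition A B × EverywhereIsomorphic A B)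
theorem1 em =
    -- Two double-negation eliminations: one extracts the interval, the other turns the absence of a
    -- counterexample into an isomorphism on each interval.
    (λ A B partition → decidable-stable em λ none →
      ¬everywhereIsomorphic partition λ a b a<b → decidable-stable em λ ¬iso → none (a , b , a<b , ¬iso))
  , λ (A , B , partition , iso) → ¬everywhereIsomorphic partition iso
  where open Classical em
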